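{- Let $B=F(b_1,\ldots,b_n)$ be a Ferrers board with $0\le b_1\le\cdots\le b_n$ and $b_n>0$, and let $B^-=F(b_1,\ldots,b_{n-1})$. Then for all $1\le k\le n$, $$\mathbf{rT}_k(B,p,q)=\mathbf{rT}_k(B^-,p,q)+F_{b_{n-(k-1)}}(p,q)\,\mathbf{rT}_{k-1}(B^-,p,q).$$
   Context: For $m\ge 1$, a Fibonacci tiling of height $m$ is a tiling of a column of height $m$ by tiles of height 1 and height 2 whose bottom-most tile has height 1. For such a tiling $T$, $\mathrm{one}(T)$ and $\mathrm{two}(T)$ denote the numbers of tiles of height 1 and 2, and $F_m(p,q)=\sum_T q^{\mathrm{one}(T)}p^{\mathrm{two}(T)}$ over all Fibonacci tilings of height $m$ (so $F_1=q$, $F_2=q^2$, $F_m=qF_{m-1}+pF_{m-2}$ for $m\ge 3$). There are no Fibonacci tilings of height $0$, and $F_0(p,q)=0$. A Ferrers board $F(b_1,\ldots,b_n)$ is the board whose columns, from left to right, have heights $b_1,\ldots,b_n$. A Fibonacci rook placement of $k$ tilings in $B=F(b_1,\ldots,b_n)$ consists of a choice of columns $1\le i_1<\cdots<i_k\le n$ together with, for each $s=1,\ldots,k$, a Fibonacci tiling of height $b_{i_s-(s-1)}$ placed in column $i_s$ (this is the number of cells of column $i_s$ not canceled by the tilings in columns $i_1,\ldots,i_{s-1}$, where each tiling cancels top cells of the columns to its right so that after placing $s$ tilings the untiled columns have $b_1,\ldots,b_{n-s}$ uncanceled cells from left to right). Its weight is $q^{a}p^{b}$ where $a$ (resp. $b$)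 is the total number of tiles of height 1 (resp. 2) used. $\mathbf{rT}_k(B,p,q)$ is the sum of the weights of all Fibonacci rook placements of $k$ tilings in $B$ (the empty placement, $k=0$, has weight 1; the sum is $0$ if there are none). -}

module Defs where

open import Algebra.Bundles using (CommutativeSemiring)
open import Data.Empty using (⊥; ⊥-elim)
open import Data.Fin.Base as Fin using (Fin; toℕ; fromℕ<)
import Data.Fin.Properties as Fin
open import Data.List.Base
  using (List; []; _∷_; [_]; _++_; map; concatMap; cartesianProductWith; allFin; foldr)
open import Data.List.Membership.Propositional using (_∈_; find; lose)
open import Data.List.Membership.Propositional.Properties
  using (∈-map⁺; ∈-map⁻; ∈-++⁺ˡ; ∈-++⁺ʳ; ∈-concatMap⁺; ∈-concatMap⁻; ∈-cartesianProductWith⁺; ∈-allFin)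
import Data.List.Relation.Unary.All as All
open import Data.List.Relation.Unary.AllPairs using ([]; _∷_)
open import Data.List.Relation.Unary.Any using (here)
open import Data.List.Relation.Unary.Any.Properties using (¬Any[])
open import Data.List.Relation.Unary.Unique.Propositional using (Unique)
import Data.List.Relation.Unary.Unique.Propositional.Properties as Unique
open import Data.Nat.Base using (ℕ; zero; suc; _+_; _∸_)
open import Data.Nat.Properties using (m∸n≤m; ≤-<-trans)
open import Data.Product.Base using (_×_; _,_; ∃-syntax)
open import Data.Vec.Base using (Vec; []; _∷_; lookup)
open import Data.Vec.Relation.Unary.Linked as Linked using (Linked; linked?)
open import Relation.Binary.PropositionalEquality using (_≡_; refl; sym; trans)
open import Relation.Nullary.Decidable using (yes; no)

-- Tilings are built from the bottom up; the bottom-most tile has height 1.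
data FibTiling : ℕ → Set where
  bottom : FibTiling 1
  _▴1    : ∀ {m} → FibTiling m → FibTiling (suc m)
  _▴2    : ∀ {m} → FibTiling m → FibTiling (suc (suc m))

one : ∀ {m} → FibTiling m → ℕ
one bottom = 1
one (t ▴1) = suc (one t)
one (t ▴2) = one t

two : ∀ {m} → FibTiling m → ℕ
two bottom = 0
two (t ▴1) = two t
two (t ▴2) = suc (two t)

fibTilings : ∀ m → List (FibTiling m)
fibTilings 0             = []
fibTilings 1             = [ bottom ]
fibTilings (suc (suc m)) = map _▴1 (fibTilings (suc m)) ++ map _▴2 (fibTilings m)

-- Columns are numbered from 0.  The subtraction is truncated, but a column
-- that comes after s chosen columns has number at least s.
_⊖_ : ∀ {n} → Fin n → ℕ → Fin n
i ⊖ s = fromℕ< (≤-<-trans (m∸n≤m (toℕ i) s) (Fin.toℕ<n i))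

-- In Tilings b s cs, s tilings have already been placed to the left of the
-- columns cs.
data Tilings {n} (b : Vec ℕ n) : ℕ → ∀ {k} → Vec (Fin n) k → Set where
  []  : ∀ {s} → Tilings b s []
  _∷_ : ∀ {s k i} {is : Vec (Fin n) k} →
        FibTiling (lookup b (i ⊖ s)) → Tilings b (suc s) is → Tilings b s (i ∷ is)

ones : ∀ {n} {b : Vec ℕ n} {s k} {cs : Vec (Fin n) k} → Tilings b s cs → ℕ
ones []       = 0
ones (t ∷ ts) = one t + ones ts

twos : ∀ {n} {b : Vec ℕ n} {s k} {cs : Vec (Fin n) k} → Tilings b s cs → ℕ
twos []       = 0
twos (t ∷ ts) = two t + twos ts

record Placement {n} (b : Vec ℕ n) (k : ℕ) : Set where
  constructor placement
  field
    columns    : Vec (Fin n) k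
    increasing : Linked Fin._<_ columns
    tilings    : Tilings b 0 columns

open Placement public

vectors : ∀ n k → List (Vec (Fin n) k)
vectors n zero    = [ [] ]
vectors n (suc k) = cartesianProductWith _∷_ (allFin n) (vectors n k)

allTilings : ∀ {n} (b : Vec ℕ n) s {k} (cs : Vec (Fin n) k) → List (Tilings b s cs)
allTilings b s []       = [ [] ]
allTilings b s (i ∷ is) =
  cartesianProductWith _∷_ (fibTilings (lookup b (i ⊖ s))) (allTilings b (suc s) is)

placementsIn : ∀ {n} (b : Vec ℕ n) {k} → Vec (Fin n) k → List (Placement b k)
placementsIn b cs with linked? Fin._<?_ cs
... | yes inc = map (placement cs inc) (allTilings b 0 cs)
... | no  _   = []

placements : ∀ {n} (b : Vec ℕ n) k → List (Placement b k)
placements {n} b k = concatMap (placementsIn b) (vectors n k)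

module Polynomials {c ℓ} (R : CommutativeSemiring c ℓ) where

  open CommutativeSemiring R using (Carrier; 0#; semiring) renaming (_+_ to _⊕_; _*_ to _⊗_)
  open import Algebra.Properties.Semiring.Exp semiring using (_^_)

  ∑ : ∀ {a} {A : Set a} → List A → (A → Carrier) → Carrier
  ∑ xs f = foldr _⊕_ 0# (map f xs)

  F : ℕ → Carrier → Carrier → Carrier
  F m p q = ∑ (fibTilings m) λ t → (q ^ one t) ⊗ (p ^ two t)

  rT : ∀ {n} → ℕ → Vec ℕ n → Carrier → Carrier → Carrier
  rT k b p q = ∑ (placements b k) λ P → (q ^ ones (tilings P)) ⊗ (p ^ twos (tilings P))

-- fibTilings and placements list every tiling and every placement exactly once,
-- so that F and rT are the sums over all of them.

∈-fibTilings : ∀ {m} (t : FibTiling m) → t ∈ fibTilings m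
∈-fibTilings bottom               = here refl
∈-fibTilings {suc zero}    (t ▴1) = ⊥-elim (¬Any[] (∈-fibTilings t))
∈-fibTilings {suc (suc m)} (t ▴1) = ∈-++⁺ˡ (∈-map⁺ _▴1 (∈-fibTilings t))
∈-fibTilings {suc (suc m)} (t ▴2) =
  ∈-++⁺ʳ (map _▴1 (fibTilings (suc m))) (∈-map⁺ _▴2 (∈-fibTilings t))

fibTilings-unique : ∀ m → Unique (fibTilings m)
fibTilings-unique 0             = []
fibTilings-unique 1             = All.[] ∷ []
fibTilings-unique (suc (suc m)) = Unique.++⁺
  (Unique.map⁺ (λ { refl → refl }) (fibTilings-unique (suc m)))
  (Unique.map⁺ (λ { refl → refl }) (fibTilings-unique m))
  λ (v∈₁ , v∈₂) → disjoint (∈-map⁻ _▴1 v∈₁) (∈-map⁻ _▴2 v∈₂)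
  where
  disjoint : ∀ {v} → ∃[ t ] t ∈ fibTilings (suc m) × v ≡ t ▴1 →
             ∃[ t ] t ∈ fibTilings m × v ≡ t ▴2 → ⊥
  disjoint (_ , _ , refl) (_ , _ , ())

∈-vectors : ∀ {n k} (cs : Vec (Fin n) k) → cs ∈ vectors n k
∈-vectors []       = here refl
∈-vectors (i ∷ is) = ∈-cartesianProductWith⁺ _∷_ (∈-allFin i) (∈-vectors is)

vectors-unique : ∀ n k → Unique (vectors n k)
vectors-unique n zero    = All.[] ∷ []
vectors-unique n (suc k) = Unique.cartesianProductWith⁺ _∷_ (λ { refl → refl , refl })
  (Unique.allFin⁺ n) (vectors-unique n k)

∈-allTilings : ∀ {n} {b : Vec ℕ n} {s k} {cs : Vec (Fin n) k} (ts : Tilings b s cs) →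
               ts ∈ allTilings b s cs
∈-allTilings []       = here refl
∈-allTilings (t ∷ ts) = ∈-cartesianProductWith⁺ _∷_ (∈-fibTilings t) (∈-allTilings ts)

allTilings-unique : ∀ {n} (b : Vec ℕ n) s {k} (cs : Vec (Fin n) k) → Unique (allTilings b s cs)
allTilings-unique b s []       = All.[] ∷ []
allTilings-unique b s (i ∷ is) = Unique.cartesianProductWith⁺ _∷_ (λ { refl → refl , refl })
  (fibTilings-unique _) (allTilings-unique b (suc s) is)

∈-placementsIn : ∀ {n} {b : Vec ℕ n} {k} (P : Placement b k) → P ∈ placementsIn b (columns P)
∈-placementsIn {b = b} (placement cs inc ts) with linked? Fin._<?_ cs
... | no ¬inc = ⊥-elim (¬inc inc)
... | yes inc′ rewrite Linked.irrelevant Fin.<-irrelevant inc inc′ =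
  ∈-map⁺ (placement cs inc′) (∈-allTilings ts)

placementsIn-columns : ∀ {n} {b : Vec ℕ n} {k} (cs : Vec (Fin n) k) {P} →
                       P ∈ placementsIn b cs → columns P ≡ cs
placementsIn-columns cs P∈ with linked? Fin._<?_ cs
... | yes inc with _ , _ , refl ← ∈-map⁻ (placement cs inc) P∈ = refl

placementsIn-unique : ∀ {n} (b : Vec ℕ n) {k} (cs : Vec (Fin n) k) → Unique (placementsIn b cs)
placementsIn-unique b cs with linked? Fin._<?_ cs
... | no  _   = []
... | yes inc = Unique.map⁺ (λ { refl → refl }) (allTilings-unique b 0 cs)

∈-placements : ∀ {n} {b : Vec ℕ n} {k} (P : Placement b k) → P ∈ placements b k
∈-placements P = ∈-concatMap⁺ (placementsIn _) (lose (∈-vectors (columns P)) (∈-placementsIn P))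

placements-unique : ∀ {n} (b : Vec ℕ n) k → Unique (placements b k)
placements-unique {n} b k = go (vectors-unique n k)
  where
  go : ∀ {css} → Unique css → Unique (concatMap (placementsIn b) css)
  go []                   = []
  go {cs ∷ css} (cs∉ ∷ u) = Unique.++⁺ (placementsIn-unique b cs) (go u)
    λ (P∈₁ , P∈₂) → let cs′ , cs′∈ , P∈ = find (∈-concatMap⁻ (placementsIn b) {xs = css} P∈₂) in
      All.lookup cs∉ cs′∈
        (trans (sym (placementsIn-columns cs P∈₁)) (placementsIn-columns cs′ P∈))

{-# OPTIONS --safe #-}

-- Summing over the tilings first, the theorem concerns the sum over all
-- sequences i₁ < ... < i_k of columns of the products of the factors
-- F_{b(i_s − (s − 1))}.  Sorting the sequences by whether they use the first
-- available column gives a recurrence for this sum, from which the recurrence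
-- for the last column follows by induction: a last column chosen as the k-th
-- has the factor F_{b(n − (k − 1))}, whatever columns precede it.
module Submission where

open import Defs
open import Algebra.Bundles using (CommutativeSemiring)
import Algebra.Properties.CommutativeSemigroup as CommutativeSemigroupProperties
open import Data.Fin.Base as Fin using (Fin; zero; suc; toℕ; fromℕ)
import Data.Fin.Properties as Fin
open import Data.List.Base
  using (List; []; _∷_; _++_; map; concatMap; cartesianProductWith; tabulate; allFin)
open import Data.List.Properties using (map-tabulate)
open import Data.Nat.Base using (ℕ; zero; suc; _∸_; _≤_; _<_; z≤n; s≤s; s<s⁻¹)
import Data.Nat.Base as ℕ
import Data.Nat.Properties as ℕ
open import Data.Vec.Base using (Vec; []; _∷_; init; last; lookup)
open import Data.Vec.Relation.Unary.Linked using (Linked; []; [-]; _∷_; linked?)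
open import Function.Base using (id; _∘_)
open import Relation.Binary.PropositionalEquality as ≡ using (_≡_)
open import Relation.Nullary using (¬_; yes; no; contradiction)

-- Column heights by number.

-- The default value 0 beyond the end of the vector is never used.
nth : ∀ {n} → Vec ℕ n → ℕ → ℕ
nth []       _       = 0
nth (x ∷ xs) zero    = x
nth (x ∷ xs) (suc i) = nth xs i

lookup≡nth : ∀ {n} (xs : Vec ℕ n) i → lookup xs i ≡ nth xs (toℕ i)
lookup≡nth (x ∷ xs) zero    = ≡.refl
lookup≡nth (x ∷ xs) (suc i) = lookup≡nth xs i

-- Reading the heights of `init xs` off `xs` itself lets one factor function serve both boards, so
-- that their sums differ only in the number of columns.
lookup-init≡nth : ∀ {n} (xs : Vec ℕ (suc n)) i → lookup (init xs) i ≡ nth xs (toℕ i)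
lookup-init≡nth (x ∷ xs) zero    = ≡.refl
lookup-init≡nth (x ∷ xs) (suc i) = lookup-init≡nth xs i

toℕ-⊖ : ∀ {n} (i : Fin n) s → toℕ (i ⊖ s) ≡ toℕ i ∸ s
toℕ-⊖ i s = Fin.toℕ-fromℕ< _

module _ {c ℓ} (R : CommutativeSemiring c ℓ) where

  open CommutativeSemiring R hiding (zero)
  open Polynomials R
  open import Algebra.Properties.Semiring.Exp semiring using (_^_; ^-homo-*)
  open import Relation.Binary.Reasoning.Setoid setoid
  open CommutativeSemigroupProperties *-commutativeSemigroup
    using (interchange; x∙yz≈y∙xz)

  -- Finite sums in a semiring.

  ∑-cong : ∀ {a} {A : Set a} (xs : List A) {f g : A → Carrier} →
           (∀ x → f x ≈ g x) → ∑ xs f ≈ ∑ xs g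
  ∑-cong []       f≈g = refl
  ∑-cong (x ∷ xs) f≈g = +-cong (f≈g x) (∑-cong xs f≈g)

  ∑-zero : ∀ {a} {A : Set a} (xs : List A) → ∑ xs (λ _ → 0#) ≈ 0#
  ∑-zero []       = refl
  ∑-zero (x ∷ xs) = trans (+-identityˡ _) (∑-zero xs)

  ∑-map : ∀ {a b} {A : Set a} {B : Set b} (g : A → B) (xs : List A) (f : B → Carrier) →
          ∑ (map g xs) f ≈ ∑ xs (f ∘ g)
  ∑-map g []       f = refl
  ∑-map g (x ∷ xs) f = +-congˡ (∑-map g xs f)

  ∑-++ : ∀ {a} {A : Set a} (xs ys : List A) (f : A → Carrier) →
         ∑ (xs ++ ys) f ≈ ∑ xs f + ∑ ys f
  ∑-++ []       ys f = sym (+-identityˡ _)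
  ∑-++ (x ∷ xs) ys f = trans (+-congˡ (∑-++ xs ys f)) (sym (+-assoc _ _ _))

  ∑-concatMap : ∀ {a b} {A : Set a} {B : Set b} (g : A → List B) (xs : List A)
                (f : B → Carrier) → ∑ (concatMap g xs) f ≈ ∑ xs λ x → ∑ (g x) f
  ∑-concatMap g []       f = refl
  ∑-concatMap g (x ∷ xs) f = trans (∑-++ (g x) _ f) (+-congˡ (∑-concatMap g xs f))

  ∑-cartesianProductWith :
    ∀ {a b d} {A : Set a} {B : Set b} {D : Set d} (g : A → B → D)
    (xs : List A) (ys : List B) (f : D → Carrier) →
    ∑ (cartesianProductWith g xs ys) f ≈ ∑ xs λ x → ∑ ys λ y → f (g x y)
  ∑-cartesianProductWith g []       ys f = refl
  ∑-cartesianProductWith g (x ∷ xs) ys f =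
    trans (∑-++ (map (g x) ys) _ f)
      (+-cong (∑-map (g x) ys f) (∑-cartesianProductWith g xs ys f))

  *-distribˡ-∑ : ∀ {a} {A : Set a} (x : Carrier) (ys : List A) (f : A → Carrier) →
                 ∑ ys (λ y → x * f y) ≈ x * ∑ ys f
  *-distribˡ-∑ x []       f = sym (zeroʳ x)
  *-distribˡ-∑ x (y ∷ ys) f = trans (+-congˡ (*-distribˡ-∑ x ys f)) (sym (distribˡ x _ _))

  *-distribʳ-∑ : ∀ {a} {A : Set a} (x : Carrier) (ys : List A) (f : A → Carrier) →
                 ∑ ys (λ y → f y * x) ≈ ∑ ys f * x
  *-distribʳ-∑ x []       f = sym (zeroˡ x)
  *-distribʳ-∑ x (y ∷ ys) f = trans (+-congˡ (*-distribʳ-∑ x ys f)) (sym (distribʳ x _ _))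

  ∑-allFin-suc : ∀ n (f : Fin (suc n) → Carrier) →
                 ∑ (allFin (suc n)) f ≈ f zero + ∑ (allFin n) (f ∘ suc)
  ∑-allFin-suc n f = +-congˡ (begin
    ∑ (tabulate suc) f  ≡⟨ ≡.cong (λ xs → ∑ xs f) (map-tabulate id suc) ⟨
    ∑ (map suc (allFin n)) f           ≈⟨ ∑-map suc (allFin n) f ⟩
    ∑ (allFin n) (f ∘ suc)             ∎)

  -- Sums over the columns from a bound on.

  [_≤_]_ : ℕ → ℕ → Carrier → Carrier
  [ zero  ≤ i     ] x = x
  [ suc l ≤ zero  ] x = 0#
  [ suc l ≤ suc i ] x = [ l ≤ i ] x

  []-cong : ∀ l i {x y} → x ≈ y → [ l ≤ i ] x ≈ [ l ≤ i ] y
  []-cong zero    i       x≈y = x≈y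
  []-cong (suc l) zero    x≈y = refl
  []-cong (suc l) (suc i) x≈y = []-cong l i x≈y

  []-zero : ∀ l i → [ l ≤ i ] 0# ≈ 0#
  []-zero zero    i       = refl
  []-zero (suc l) zero    = refl
  []-zero (suc l) (suc i) = []-zero l i

  []-true : ∀ {l i} x → l ≤ i → [ l ≤ i ] x ≈ x
  []-true x z≤n       = refl
  []-true x (s≤s l≤i) = []-true x l≤i

  []-false : ∀ {l i} x → i < l → [ l ≤ i ] x ≈ 0#
  []-false {suc l} {zero}  x _   = refl
  []-false {suc l} {suc i} x i<l = []-false x (s<s⁻¹ i<l)

  ∑-[]-distrib : ∀ {a} {A : Set a} l i (xs : List A) (f : A → Carrier) →
                 ∑ xs (λ x → [ l ≤ i ] f x) ≈ [ l ≤ i ] ∑ xs f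
  ∑-[]-distrib zero    i       xs f = refl
  ∑-[]-distrib (suc l) zero    xs f = ∑-zero xs
  ∑-[]-distrib (suc l) (suc i) xs f = ∑-[]-distrib l i xs f

  ∑≥-empty : ∀ n (h : Fin n → Carrier) → ∑ (allFin n) (λ i → [ n ≤ toℕ i ] h i) ≈ 0#
  ∑≥-empty n h = trans (∑-cong (allFin n) λ i → []-false _ (Fin.toℕ<n i)) (∑-zero (allFin n))

  -- Column 0 is split off and the others are shifted down by one. `[_≤_]_` recurses on both
  -- numbers, so lowering the bound and the column together holds by computation.
  ∑≥-step : ∀ {n l} (h : ℕ → Carrier) → l < n →
            ∑ (allFin n) (λ i → [ l ≤ toℕ i ] h (toℕ i)) ≈
            h l + ∑ (allFin n) (λ i → [ suc l ≤ toℕ i ] h (toℕ i))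
  ∑≥-step {suc n} {zero} h _ = begin
    ∑ (allFin (suc n)) (λ i → h (toℕ i))         ≈⟨ ∑-allFin-suc n _ ⟩
    -- The inserted `0#` is the term of column 0 in the sum with bound 1.
    h 0 + ∑ (allFin n) (λ i → h (suc (toℕ i)))   ≈⟨ +-congˡ (+-identityˡ _) ⟨
    h 0 + (0# + ∑ (allFin n) (λ i → h (suc (toℕ i))))
      ≈⟨ +-congˡ (∑-allFin-suc n _) ⟨
    h 0 + ∑ (allFin (suc n)) (λ i → [ 1 ≤ toℕ i ] h (toℕ i)) ∎
  ∑≥-step {suc n} {suc l} h l<n = begin
    ∑ (allFin (suc n)) (λ i → [ suc l ≤ toℕ i ] h (toℕ i))
      ≈⟨ trans (∑-allFin-suc n _) (+-identityˡ _) ⟩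
    ∑ (allFin n) (λ i → [ l ≤ toℕ i ] h (suc (toℕ i)))
      ≈⟨ ∑≥-step (h ∘ suc) (s<s⁻¹ l<n) ⟩
    h (suc l) + ∑ (allFin n) (λ i → [ suc l ≤ toℕ i ] h (suc (toℕ i)))
      ≈⟨ +-congˡ (trans (∑-allFin-suc n _) (+-identityˡ _)) ⟨
    h (suc l) + ∑ (allFin (suc n)) (λ i → [ suc (suc l) ≤ toℕ i ] h (toℕ i)) ∎

  -- Choices of columns, with an arbitrary factor for each height index.

  module _ (f : ℕ → Carrier) where

    -- The total weight of the choices of k columns among l, ..., l + m − 1 to
    -- the left of which s columns have been chosen.
    choices : ℕ → ℕ → ℕ → ℕ → Carrier
    choices m       l s zero    = 1#
    choices zero    l s (suc k) = 0#
    choices (suc m) l s (suc k) =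
      f (l ∸ s) * choices m (suc l) (suc s) k + choices m (suc l) s (suc k)

    -- Induction on `m` along the recursion at the first column. Column `l + m` is the last one, and
    -- `s + k` columns precede it when it is chosen. Using column `l` moves one from `k` to `s`,
    -- skipping it changes neither, so the last factor is the same in both cases.
    choices-last : ∀ m l s k →
      choices (suc m) l s (suc k) ≈
      choices m l s (suc k) + f (l ℕ.+ m ∸ (s ℕ.+ k)) * choices m l s k
    choices-last zero l s zero
      rewrite ℕ.+-identityʳ l | ℕ.+-identityʳ s = +-comm _ _
    -- One column cannot supply two choices, so both sides vanish.
    choices-last zero l s (suc k) =
      trans (+-identityʳ _) (trans (zeroʳ _) (sym (trans (+-identityˡ _) (zeroʳ _))))
    choices-last (suc m) l s zero
      rewrite ℕ.+-suc l m = begin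
      f (l ∸ s) * 1# + choices (suc m) (suc l) s 1
        ≈⟨ +-congˡ (choices-last m (suc l) s zero) ⟩
      f (l ∸ s) * 1# + (choices m (suc l) s 1 + _)
        ≈⟨ +-assoc _ _ _ ⟨
      f (l ∸ s) * 1# + choices m (suc l) s 1 + _ ∎
    choices-last (suc m) l s (suc k)
      rewrite ℕ.+-suc l m | ℕ.+-suc s k = begin
      a * choices (suc m) (suc l) (suc s) (suc k) + choices (suc m) (suc l) s (suc (suc k))
        ≈⟨ +-cong (*-congˡ (choices-last m (suc l) (suc s) k))
                  (choices-last m (suc l) s (suc k)) ⟩
      a * (x + z * y) + (u + f (suc (l ℕ.+ m) ∸ (s ℕ.+ suc k)) * v)
        -- After a used first column the hypothesis subtracts `suc s + k`, after a skipped one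
        -- `s + suc k`; identifying them makes `z` a common factor.
        ≡⟨ ≡.cong (λ j → a * (x + z * y) + (u + f (suc (l ℕ.+ m) ∸ j) * v)) (ℕ.+-suc s k) ⟩
      a * (x + z * y) + (u + z * v)
        ≈⟨ +-congʳ (trans (distribˡ a x _) (+-congˡ (x∙yz≈y∙xz a z y))) ⟩
      (a * x + z * (a * y)) + (u + z * v)
        ≈⟨ +-interchange _ _ _ _ ⟩
      (a * x + u) + (z * (a * y) + z * v)
        ≈⟨ +-congˡ (distribˡ z _ _) ⟨
      (a * x + u) + z * (a * y + v) ∎
      where
      open CommutativeSemigroupProperties +-commutativeSemigroup
        using () renaming (interchange to +-interchange)
      a = f (l ∸ s)
      x = choices m (suc l) (suc s) (suc k)
      y = choices m (suc l) (suc s) k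
      z = f (suc (l ℕ.+ m) ∸ suc (s ℕ.+ k))
      u = choices m (suc l) s (suc (suc k))
      v = choices m (suc l) s (suc k)

    -- Sums over column sequences.

    weight : ∀ {n} → ℕ → ∀ {k} → Vec (Fin n) k → Carrier
    weight s []       = 1#
    weight s (i ∷ is) = f (toℕ i ∸ s) * weight (suc s) is

    -- The weight of the sequences that are increasing and start at l or later,
    -- and 0 for all others.
    weight≥ : ∀ {n} → ℕ → ℕ → ∀ {k} → Vec (Fin n) k → Carrier
    weight≥ l s []       = 1#
    weight≥ l s (i ∷ is) = [ l ≤ toℕ i ] (f (toℕ i ∸ s) * weight≥ (suc (toℕ i)) (suc s) is)

    weight≥-increasing : ∀ {n l} s {k} {i : Fin n} {is : Vec (Fin n) k} →
      l ≤ toℕ i → Linked Fin._<_ (i ∷ is) → weight≥ l s (i ∷ is) ≈ weight s (i ∷ is)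
    weight≥-increasing s l≤i [-] = []-true _ l≤i
    weight≥-increasing s {i = i} {is = _ ∷ _} l≤i (i<j ∷ inc) =
      -- `i<j` unfolds to `suc (toℕ i) ≤ toℕ j`, the bound required of the tail.
      trans ([]-true _ l≤i) (*-congˡ (weight≥-increasing {l = suc (toℕ i)} (suc s) i<j inc))

    -- When `j` does not exceed `i`, the bracket at `j` already makes the tail vanish; the
    -- assumption covers the other case.
    weight≥-∷-zero : ∀ {n} l s {k} (i j : Fin n) (is : Vec (Fin n) k) →
      (i Fin.< j → weight≥ (suc (toℕ i)) (suc s) (j ∷ is) ≈ 0#) →
      weight≥ l s (i ∷ j ∷ is) ≈ 0#
    weight≥-∷-zero l s i j is i<j⇒tail≈0 =
      trans ([]-cong l (toℕ i) (trans (*-congˡ tail≈0) (zeroʳ _))) ([]-zero l (toℕ i))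
      where
      tail≈0 : weight≥ (suc (toℕ i)) (suc s) (j ∷ is) ≈ 0#
      tail≈0 with i Fin.<? j
      ... | yes i<j = i<j⇒tail≈0 i<j
      ... | no  i≮j = []-false _ (s≤s (ℕ.≮⇒≥ i≮j))

    weight≥-nonincreasing : ∀ {n} l s {k} (is : Vec (Fin n) k) →
      ¬ Linked Fin._<_ is → weight≥ l s is ≈ 0#
    weight≥-nonincreasing l s []           ¬inc = contradiction [] ¬inc
    weight≥-nonincreasing l s (i ∷ [])     ¬inc = contradiction [-] ¬inc
    weight≥-nonincreasing l s (i ∷ j ∷ is) ¬inc = weight≥-∷-zero l s i j is λ i<j →
      weight≥-nonincreasing (suc (toℕ i)) (suc s) (j ∷ is) λ inc → ¬inc (i<j ∷ inc)

    -- The bracket and the factor of the first column do not depend on the tail and leave the inner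
    -- sum.
    ∑-weight≥-suc : ∀ n l s k →
      ∑ (vectors n (suc k)) (weight≥ l s) ≈
      ∑ (allFin n) λ i →
        [ l ≤ toℕ i ] (f (toℕ i ∸ s) * ∑ (vectors n k) (weight≥ (suc (toℕ i)) (suc s)))
    ∑-weight≥-suc n l s k =
      trans (∑-cartesianProductWith _∷_ (allFin n) (vectors n k) _)
        (∑-cong (allFin n) λ i →
          trans (∑-[]-distrib l (toℕ i) (vectors n k) _)
            ([]-cong l (toℕ i) (*-distribˡ-∑ _ (vectors n k) _)))

    -- The sequences starting at `l` and those starting later give the two summands in the recursion
    -- of `choices`; `m` counts the columns still available.
    ∑-weight≥ : ∀ {n} m l s k → l ℕ.+ m ≡ n →
                ∑ (vectors n k) (weight≥ l s) ≈ choices m l s k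
    ∑-weight≥ m l s zero _ = +-identityʳ 1#
    ∑-weight≥ {n} zero l s (suc k) ≡.refl rewrite ℕ.+-identityʳ l =
      trans (∑-weight≥-suc l l s k) (∑≥-empty l _)
    ∑-weight≥ {n} (suc m) l s (suc k) l+m≡n = begin
      ∑ (vectors n (suc k)) (weight≥ l s)
        ≈⟨ ∑-weight≥-suc n l s k ⟩
      ∑ (allFin n) (λ i → [ l ≤ toℕ i ] h (toℕ i))
        ≈⟨ ∑≥-step h (≡.subst (l <_) l+m≡n (ℕ.m<m+n l (s≤s z≤n))) ⟩
      h l + ∑ (allFin n) (λ i → [ suc l ≤ toℕ i ] h (toℕ i))
        -- The terms beyond `l` are folded back into a sum over sequences with bound `suc l`.
        ≈⟨ +-congˡ (∑-weight≥-suc n (suc l) s k) ⟨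
      h l + ∑ (vectors n (suc k)) (weight≥ (suc l) s)
        ≈⟨ +-cong (*-congˡ (∑-weight≥ m (suc l) (suc s) k l+m≡n′))
                  (∑-weight≥ m (suc l) s (suc k) l+m≡n′) ⟩
      choices (suc m) l s (suc k) ∎
      where
      h : ℕ → Carrier
      h i = f (i ∸ s) * ∑ (vectors n k) (weight≥ (suc i) (suc s))
      l+m≡n′ : suc l ℕ.+ m ≡ n
      l+m≡n′ = ≡.trans (≡.sym (ℕ.+-suc l m)) l+m≡n

    -- From placements to column sequences.

    module _ (p q : Carrier) {n} (b : Vec ℕ n)
             (F-column : ∀ i → F (lookup b i) p q ≈ f (toℕ i)) where

      -- Tile counts add, so weights multiply; the tilings of the chosen columns are independent, so
      -- the sum factors into one `F` per column.
      ∑-allTilings : ∀ s {k} (cs : Vec (Fin n) k) →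
        ∑ (allTilings b s cs) (λ ts → (q ^ ones ts) * (p ^ twos ts)) ≈ weight s cs
      ∑-allTilings s []       = trans (+-identityʳ _) (*-identityˡ _)
      ∑-allTilings s (i ∷ is) = begin
        ∑ (allTilings b s (i ∷ is)) w
          ≈⟨ ∑-cartesianProductWith _∷_ ts (allTilings b (suc s) is) w ⟩
        ∑ ts (λ t → ∑ tss λ ts′ → (q ^ (one t ℕ.+ ones ts′)) * (p ^ (two t ℕ.+ twos ts′)))
          ≈⟨ (∑-cong ts λ t → trans (∑-cong tss (w-∷ t)) (*-distribˡ-∑ _ tss _)) ⟩
        ∑ ts (λ t → (q ^ one t) * (p ^ two t) * ∑ tss w)
          ≈⟨ *-distribʳ-∑ _ ts _ ⟩
        F (lookup b (i ⊖ s)) p q * ∑ tss w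
          ≈⟨ *-cong (F-column (i ⊖ s)) (∑-allTilings (suc s) is) ⟩
        f (toℕ (i ⊖ s)) * weight (suc s) is
          ≡⟨ ≡.cong (λ j → f j * weight (suc s) is) (toℕ-⊖ i s) ⟩
        weight s (i ∷ is) ∎
        where
        ts  = fibTilings (lookup b (i ⊖ s))
        tss = allTilings b (suc s) is
        w : ∀ {s k} {cs : Vec (Fin n) k} → Tilings b s cs → Carrier
        w ts = (q ^ ones ts) * (p ^ twos ts)
        w-∷ : ∀ {m} (t : FibTiling m) (ts : Tilings b (suc s) is) →
              (q ^ (one t ℕ.+ ones ts)) * (p ^ (two t ℕ.+ twos ts)) ≈
              (q ^ one t) * (p ^ two t) * w ts
        w-∷ t ts = trans (*-cong (^-homo-* q (one t) (ones ts)) (^-homo-* p (two t) (twos ts)))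
          (interchange _ _ _ _)

      ∑-placementsIn : ∀ {k} (cs : Vec (Fin n) k) →
        ∑ (placementsIn b cs) (λ P → (q ^ ones (tilings P)) * (p ^ twos (tilings P))) ≈
        weight≥ 0 0 cs
      ∑-placementsIn cs with linked? Fin._<?_ cs
      ... | no ¬inc = sym (weight≥-nonincreasing 0 0 cs ¬inc)
      ... | yes inc =
        trans (∑-map (placement cs inc) (allTilings b 0 cs) _)
          (trans (∑-allTilings 0 cs) (sym (weight≥-weight cs inc)))
        where
        weight≥-weight : ∀ {k} (cs : Vec (Fin n) k) → Linked Fin._<_ cs →
                         weight≥ 0 0 cs ≈ weight 0 cs
        weight≥-weight []      _   = refl
        weight≥-weight (_ ∷ _) inc = weight≥-increasing 0 z≤n inc

      rT≈choices : ∀ k → rT k b p q ≈ choices n 0 0 k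
      rT≈choices k = begin
        rT k b p q                         ≈⟨ ∑-concatMap (placementsIn b) (vectors n k) _ ⟩
        ∑ (vectors n k) _                  ≈⟨ ∑-cong (vectors n k) ∑-placementsIn ⟩
        ∑ (vectors n k) (weight≥ 0 0)      ≈⟨ ∑-weight≥ n 0 0 k ≡.refl ⟩
        choices n 0 0 k                    ∎

theorem3 : ∀ {c ℓ} (R : CommutativeSemiring c ℓ) (let open CommutativeSemiring R) (let open Polynomials R) (p q : Carrier)
    {n : ℕ} (b : Vec ℕ (suc n)) → Linked _≤_ b → 0 < last b →
    (k : ℕ) → 1 ≤ k → k ≤ suc n →
    rT k b p q ≈ rT k (init b) p q + F (lookup b (fromℕ n ⊖ (k ∸ 1))) p q * rT (k ∸ 1) (init b) p q
theorem3 R p q {n} b _ _ (suc k) _ _ = begin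
  rT (suc k) b p q
    ≈⟨ rT≈choices R f p q b (λ i → reflexive (≡.cong F′ (lookup≡nth b i))) (suc k) ⟩
  choices R f (suc n) 0 0 (suc k)
    -- Numbered from 0, the last column of `b` is `n`; chosen after `k` others, it has the factor
    -- `f (n ∸ k)`.
    ≈⟨ choices-last R f n 0 0 k ⟩
  choices R f n 0 0 (suc k) + f (n ∸ k) * choices R f n 0 0 k
    ≈⟨ +-cong (rT-init (suc k)) (*-cong (reflexive F-last) (rT-init k)) ⟨
  rT (suc k) (init b) p q + F (lookup b (fromℕ n ⊖ k)) p q * rT k (init b) p q ∎
  where
  open CommutativeSemiring R
  open Polynomials R
  open import Relation.Binary.Reasoning.Setoid setoid
  F′ f : ℕ → Carrier
  F′ m = F m p q
  f i  = F′ (nth b i)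
  rT-init : ∀ k → rT k (init b) p q ≈ choices R f n 0 0 k
  rT-init = rT≈choices R f p q (init b) (λ i → reflexive (≡.cong F′ (lookup-init≡nth b i)))
  F-last : F (lookup b (fromℕ n ⊖ k)) p q ≡ f (n ∸ k)
  F-last = ≡.cong F′ (≡.trans (lookup≡nth b (fromℕ n ⊖ k))
    (≡.cong (nth b) (≡.trans (toℕ-⊖ (fromℕ n) k) (≡.cong (_∸ k) (Fin.toℕ-fromℕ n)))))
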